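{- Let $t$ be a positive integer and let $G$ be a connected simple graph of order $n\geq 5$ with minimum degree $\delta(G)\geq t$. Suppose that $$|E(G)|>\binom{n-t}{2}+\frac32t^2-t+\frac12 \quad\text{if } n=5 \text{ or } n\geq 6t+1,$$ and $$|E(G)|>\binom{n-t}{2}+\frac32t^2+\frac t2 \quad\text{if } 6\leq n\leq 6t.$$ Then $G$ has a spanning tree with leaf distance at least four.
   Context: All graphs are finite, simple, undirected. A leaf of a tree is a vertex of degree one. The leaf distance of a tree $T$ is the minimum distance in $T$ between any two distinct leaves of $T$. A spanning tree of $G$ is a spanning subgraph of $G$ that is a tree. -}

module Defs where

open import Data.Nat using (ℕ; zero; suc; _+_; _*_; _≤_; _<_; _≥_)
open import Data.Fin using (Fin; toℕ)
open import Data.Fin.Properties using () renaming (_<?_ to _<ᶠ?_)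
open import Data.Bool using (Bool; true; false; if_then_else_)
open import Data.List using (List; []; _∷_; length; map; allFin)
open import Data.Nat.ListAction using (sum)
open import Data.List.Relation.Unary.Unique.Propositional using (Unique)
open import Data.List.Relation.Unary.Linked using (Linked)
open import Data.Product using (_×_; Σ; ∃; ∃-syntax)
open import Data.Empty using (⊥)
open import Relation.Nullary using (¬_; yes; no)
open import Relation.Binary.PropositionalEquality using (_≡_; _≢_)

record Graph (n : ℕ) : Set where
  field
    adj    : Fin n → Fin n → Bool
    sym    : ∀ u v → adj u v ≡ adj v u
    irrefl : ∀ u → adj u u ≡ false
open Graph public

Adj : ∀ {n} → Graph n → Fin n → Fin n → Set
Adj G u v = adj G u v ≡ true

degree : ∀ {n} → Graph n → Fin n → ℕ
degree {n} G u = sum (map (λ v → if adj G u v then 1 else 0) (allFin n))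

edgeCount : ∀ {n} → Graph n → ℕ
edgeCount {n} G =
  sum (map (λ u → sum (map (λ v → if adj G u v then (isLt u v) else 0) (allFin n))) (allFin n))
  where
  isLt : Fin n → Fin n → ℕ
  isLt u v with u <ᶠ? v
  ... | yes _ = 1
  ... | no _  = 0

minDegree≥ : ∀ {n} → Graph n → ℕ → Set
minDegree≥ G t = ∀ u → t ≤ degree G u

data Walk {n : ℕ} (G : Graph n) : Fin n → Fin n → ℕ → Set where
  nil  : ∀ {u} → Walk G u u 0
  cons : ∀ {u v w k} → Adj G u v → Walk G v w k → Walk G u w (suc k)

Connected : ∀ {n} → Graph n → Set
Connected G = ∀ u v → ∃[ k ] Walk G u v k

lastOf : ∀ {n} → Fin n → List (Fin n) → Fin n
lastOf y [] = y
lastOf y (z ∷ zs) = lastOf z zs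

IsCycle : ∀ {n} → Graph n → List (Fin n) → Set
IsCycle G [] = ⊥
IsCycle G (x ∷ []) = ⊥
IsCycle G (x ∷ y ∷ zs) =
  3 ≤ length (x ∷ y ∷ zs) × Unique (x ∷ y ∷ zs)
  × Linked (Adj G) (x ∷ y ∷ zs) × Adj G (lastOf y zs) x

Acyclic : ∀ {n} → Graph n → Set
Acyclic G = ∀ cs → ¬ IsCycle G cs

IsTree : ∀ {n} → Graph n → Set
IsTree G = Connected G × Acyclic G

IsSpanningTree : ∀ {n} → Graph n → Graph n → Set
IsSpanningTree G T = (∀ u v → Adj T u v → Adj G u v) × IsTree T

IsLeaf : ∀ {n} → Graph n → Fin n → Set
IsLeaf T u = degree T u ≡ 1

LeafDistance≥ : ∀ {n} → Graph n → ℕ → Set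
LeafDistance≥ T d = ∀ u v → IsLeaf T u → IsLeaf T v → u ≢ v →
  ∀ k → Walk T u v k → d ≤ k

{-# OPTIONS --safe #-}
module Submission where

-- Under these bounds G has a Hamiltonian cycle, hence a Hamiltonian path, which is a spanning
-- tree whose only leaves are its ends, at distance n - 1 ≥ 4.
-- Joining non-adjacent vertices of degree sum at least n does not affect Hamiltonicity
-- (Bondy and Chvátal), so take G closed under this. If G is not complete, let u, v be
-- non-adjacent with maximal degree sum, h = d(u) ≤ d(v). A vertex missing u has degree at most
-- d(v) < n - h and one missing v has degree at most h; summing all degrees gives Erdős' bound
-- 2|E| ≤ (n - h)(n - h - 1) + 2h² with t ≤ h < n/2, against the hypothesis.

open import Defs
open import Data.Nat using (ℕ; zero; suc; _+_; _*_; _∸_; _≤_; _<_; z≤n; s≤s; s≤s⁻¹; _≤?_; _<?_; _≟_)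
open import Data.Nat.Combinatorics using (_C_; nC1≡n; nCk+nC[k+1]≡[n+1]C[k+1])
open import Data.Nat.ListAction using (sum)
open import Data.Nat.ListAction.Properties using (sum-↭; sum-++)
open import Data.Nat.Properties hiding (_≟_; _≤?_; _<?_)
open import Data.Nat.Tactic.RingSolver using (solve-∀)
open import Data.Fin using (Fin; zero; suc; toℕ; fromℕ<)
import Data.Fin.Properties as Fin
open import Data.Bool using (Bool; true; false; if_then_else_)
import Data.Bool.Properties as Bool
open import Data.List using (List; []; _∷_; _++_; length; map; allFin; lookup)
open import Data.List.Properties using (length-tabulate; length-++; map-++; map-tabulate)
open import Data.List.Membership.Propositional using (_∈_)
open import Data.List.Membership.Propositional.Properties using (∈-allFin; ∈-lookup)
open import Data.List.Relation.Unary.Any using (index)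
open import Data.List.Relation.Unary.Any.Properties using (lookup-index)
open import Data.List.Relation.Unary.All as All using (All; []; _∷_)
open import Data.List.Relation.Unary.AllPairs using ([]; _∷_)
open import Data.List.Relation.Unary.Linked using (Linked; []; [-]; _∷_)
open import Data.List.Relation.Unary.Unique.Propositional using (Unique)
open import Data.List.Relation.Unary.Unique.Propositional.Properties using (allFin⁺)
open import Data.List.Relation.Binary.Permutation.Propositional using (_↭_; ↭-refl; ↭-reflexive; ↭-sym; ↭-trans; prep; ↭⇒↭ₛ)
open import Data.List.Relation.Binary.Permutation.Propositional.Properties using (++-comm; ++⁺ˡ; ↭-length; shift; map⁺; ∷↭∷ʳ; ∈-resp-↭)
import Data.List.Relation.Binary.Permutation.Setoid.Properties as ↭ₛ
open import Data.Product using (_×_; _,_; proj₁; ∃; ∃-syntax)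
open import Data.Sum using (_⊎_; inj₁; inj₂; swap)
open import Function using (_∘_; id; mk⇔)
open import Relation.Nullary using (does; yes; no; ¬_)
open import Relation.Nullary.Decidable using (does-⇔; dec-true; dec-false; decidable-stable; _⊎-dec_; _×-dec_; ¬?)
open import Relation.Nullary.Negation using (contradiction)
open import Relation.Binary.Definitions using (Symmetric; Decidable)
open import Relation.Binary.PropositionalEquality using (_≡_; _≢_; refl; cong; cong₂; trans; subst; subst₂; setoid; module ≡-Reasoning) renaming (sym to ≡-sym)

private variable
  A B : Set
  n : ℕ

-- Sums over lists and over the vertices.

[_]ᵇ : Bool → ℕ
[ b ]ᵇ = if b then 1 else 0

[]ᵇ≤1 : ∀ b → [ b ]ᵇ ≤ 1
[]ᵇ≤1 true  = ≤-refl
[]ᵇ≤1 false = z≤n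

sum-map-mono : ∀ {f g : A → ℕ} → (∀ x → f x ≤ g x) → ∀ xs → sum (map f xs) ≤ sum (map g xs)
sum-map-mono f≤g []       = z≤n
sum-map-mono f≤g (x ∷ xs) = +-mono-≤ (f≤g x) (sum-map-mono f≤g xs)

sum-map-+ : ∀ (f g : A → ℕ) xs → sum (map (λ x → f x + g x) xs) ≡ sum (map f xs) + sum (map g xs)
sum-map-+ f g []       = refl
sum-map-+ f g (x ∷ xs) = trans (cong (f x + g x +_) (sum-map-+ f g xs)) (interchange (f x) (g x) _ _)
  where
  interchange : ∀ a b c d → a + b + (c + d) ≡ a + c + (b + d)
  interchange = solve-∀

sum-map-* : ∀ (f : A → ℕ) c xs → sum (map (λ x → f x * c) xs) ≡ sum (map f xs) * c
sum-map-* f c []       = refl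
sum-map-* f c (x ∷ xs) = trans (cong (f x * c +_) (sum-map-* f c xs)) (≡-sym (*-distribʳ-+ c (f x) _))

sum-map-const : ∀ c (xs : List A) → sum (map (λ _ → c) xs) ≡ length xs * c
sum-map-const c []       = refl
sum-map-const c (x ∷ xs) = cong (c +_) (sum-map-const c xs)

sum-map-swap : ∀ (f : A → B → ℕ) xs ys →
  sum (map (λ x → sum (map (f x) ys)) xs) ≡ sum (map (λ y → sum (map (λ x → f x y) xs)) ys)
sum-map-swap f []       ys = ≡-sym (trans (sum-map-const 0 ys) (*-zeroʳ (length ys)))
sum-map-swap f (x ∷ xs) ys = trans (cong (sum (map (f x) ys) +_) (sum-map-swap f xs ys))
  (≡-sym (sum-map-+ (f x) _ ys))

∑ : (Fin n → ℕ) → ℕ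
∑ {n} f = sum (map f (allFin n))

∑-const : ∀ c → ∑ {n} (λ _ → c) ≡ n * c
∑-const {n} c = trans (sum-map-const c (allFin n)) (cong (_* c) (length-tabulate {n = n} id))

∑-suc : (f : Fin (suc n) → ℕ) → ∑ f ≡ f zero + ∑ (f ∘ suc)
∑-suc f = cong (λ ys → f zero + sum ys) (trans (map-tabulate suc f) (≡-sym (map-tabulate id (f ∘ suc))))

δ : Fin n → Fin n → ℕ
δ v w = [ does (w Fin.≟ v) ]ᵇ

∑-δ : (v : Fin n) → ∑ (δ v) ≡ 1
∑-δ {suc n} zero    = trans (∑-suc {n} (δ zero)) (cong suc (trans (∑-const {n} 0) (*-zeroʳ n)))
∑-δ {suc n} (suc v) = trans (∑-suc {n} (δ (suc v))) (∑-δ v)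

-- Degree sums and the handshake inequality.

degreeSum : Graph n → ℕ
degreeSum G = ∑ (degree G)

private
  -- The weight in edgeCount uses a function local to it; unification recovers it.
  edgeCount-∑ : ∀ {n} (G : Graph n) → ∃ λ (e : Fin n → Fin n → ℕ) → edgeCount G ≡ ∑ (λ u → ∑ (λ v → e u v))
  edgeCount-∑ G = _ , refl

  edgeWeight-sym : (G : Graph n) (u v : Fin n) →
    proj₁ (edgeCount-∑ G) u v + proj₁ (edgeCount-∑ G) v u ≤ [ adj G u v ]ᵇ
  edgeWeight-sym G u v with adj G u v | adj G v u | sym G u v | u Fin.<? v | v Fin.<? u
  ... | false | .false | refl | _      | _      = z≤n
  ... | true  | .true  | refl | yes u<v | yes v<u = contradiction v<u (<-asym u<v)
  ... | true  | .true  | refl | yes _  | no _   = ≤-refl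
  ... | true  | .true  | refl | no _   | yes _  = ≤-refl
  ... | true  | .true  | refl | no _   | no _   = z≤n

-- Half of the handshake lemma: exchanging the order of summation pairs the weight of (u, v) with
-- that of (v, u), and at most one of u < v and v < u holds.
2*edgeCount≤degreeSum : (G : Graph n) → 2 * edgeCount G ≤ degreeSum G
2*edgeCount≤degreeSum {n} G = begin
  2 * edgeCount G                                    ≡⟨ cong (edgeCount G +_) (+-identityʳ _) ⟩
  ∑ (λ u → ∑ (e u)) + ∑ (λ u → ∑ (e u))              ≡⟨ cong (∑ (λ u → ∑ (e u)) +_) (sum-map-swap e V V) ⟩
  ∑ (λ u → ∑ (e u)) + ∑ (λ u → ∑ (λ v → e v u))      ≡⟨ sum-map-+ (λ u → ∑ (e u)) _ V ⟨
  ∑ (λ u → ∑ (e u) + ∑ (λ v → e v u))                ≤⟨ sum-map-mono (λ u → ≤-reflexive (≡-sym (sum-map-+ (e u) _ V))) V ⟩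
  ∑ (λ u → ∑ (λ v → e u v + e v u))                  ≤⟨ sum-map-mono (λ u → sum-map-mono (edgeWeight-sym G u) V) V ⟩
  degreeSum G                                        ∎
  where
  open ≤-Reasoning
  V = allFin n
  e = proj₁ (edgeCount-∑ G)

-- Graphs from decidable relations, and one round of the Bondy-Chvátal closure.

Adj? : (G : Graph n) → Decidable (Adj G)
Adj? G u v = adj G u v Bool.≟ true

Adj-sym : (G : Graph n) → Symmetric (Adj G)
Adj-sym G {u} {v} uv = trans (sym G v u) uv

Adj-irrefl : (G : Graph n) {u : Fin n} → ¬ Adj G u u
Adj-irrefl G {u} uu with () ← trans (≡-sym uu) (irrefl G u)

module _ {R : Fin n → Fin n → Set} (R? : Decidable R) (R-sym : Symmetric R) (R-irrefl : ∀ u → ¬ R u u) where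

  fromRelation : Graph n
  fromRelation .adj u v  = does (R? u v)
  fromRelation .sym u v  = does-⇔ (mk⇔ R-sym R-sym) (R? u v) (R? v u)
  fromRelation .irrefl u = dec-false (R? u u) (R-irrefl u)

  fromRelation⁺ : ∀ {u v} → R u v → Adj fromRelation u v
  fromRelation⁺ {u} {v} = dec-true (R? u v)

  fromRelation⁻ : ∀ {u v} → Adj fromRelation u v → R u v
  fromRelation⁻ {u} {v} uv with R? u v
  ... | yes r = r

module _ {n} (G : Graph n) where

  Joinable : Fin n → Fin n → Set
  Joinable u v = Adj G u v ⊎ (u ≢ v × n ≤ degree G u + degree G v)

  Joinable? : Decidable Joinable
  Joinable? u v = Adj? G u v ⊎-dec (¬? (u Fin.≟ v) ×-dec (n ≤? degree G u + degree G v))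

  Joinable-sym : Symmetric Joinable
  Joinable-sym (inj₁ uv) = inj₁ (Adj-sym G uv)
  Joinable-sym {u} {v} (inj₂ (u≢v , n≤)) =
    inj₂ ((u≢v ∘ ≡-sym) , ≤-trans n≤ (≤-reflexive (+-comm (degree G u) (degree G v))))

  Joinable-irrefl : ∀ u → ¬ Joinable u u
  Joinable-irrefl u (inj₁ uu)        = Adj-irrefl G uu
  Joinable-irrefl u (inj₂ (u≢u , _)) = u≢u refl

  -- A single round: pairs are judged by their degrees in `G` and all qualifying ones are joined at
  -- once. The iteration takes place in `erdős`.
  closure : Graph n
  closure = fromRelation Joinable? Joinable-sym Joinable-irrefl

  closure⁺ : ∀ {u v} → Joinable u v → Adj closure u v
  closure⁺ {u} {v} = fromRelation⁺ Joinable? Joinable-sym Joinable-irrefl {u} {v}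

  closure⁻ : ∀ {u v} → Adj closure u v → Joinable u v
  closure⁻ {u} {v} = fromRelation⁻ Joinable? Joinable-sym Joinable-irrefl {u} {v}

-- Trails with jumps, and rerouting a spanning cycle around a jump.

moveEnds : ∀ (a b c : A) {vs ws} → b ∷ ws ↭ c ∷ vs → a ∷ ws ++ b ∷ [] ↭ c ∷ a ∷ vs
moveEnds a b c {vs} {ws} r = ↭-trans (prep a (↭-trans (↭-sym (∷↭∷ʳ b ws)) r)) (shift c (a ∷ []) vs)

-- The index k counts the steps that are not edges of G; vs lists every vertex but the last one,
-- so that concatenation adds up both.
data Trail {n} (G : Graph n) : Fin n → Fin n → ℕ → List (Fin n) → Set where
  []   : ∀ {a} → Trail G a a 0 []
  edge : ∀ {a b c k vs} → Adj G a b → Trail G b c k vs → Trail G a c k (a ∷ vs)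
  jump : ∀ {a b c k vs} → ¬ Adj G a b → n ≤ degree G a + degree G b →
         Trail G b c k vs → Trail G a c (suc k) (a ∷ vs)

module _ {n} {G : Graph n} where

  infixr 5 _++ᵗ_
  _++ᵗ_ : ∀ {a b c k m vs ws} → Trail G a b k vs → Trail G b c m ws → Trail G a c (k + m) (vs ++ ws)
  []           ++ᵗ q = q
  edge e p     ++ᵗ q = edge e (p ++ᵗ q)
  jump ¬e ≥n p ++ᵗ q = jump ¬e ≥n (p ++ᵗ q)

  -- Each list omits the end of its own trail, so the two agree once these ends are put back.
  reverseᵗ : ∀ {a b k vs} → Trail G a b k vs → ∃[ ws ] Trail G b a k ws × a ∷ ws ↭ b ∷ vs
  reverseᵗ [] = [] , [] , ↭-refl
  reverseᵗ {a} {c} (edge {b = b} {k = k} e p) with ws , p′ , b∷ws↭ ← reverseᵗ p =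
    ws ++ b ∷ [] , subst (λ k → Trail G c a k (ws ++ b ∷ [])) (+-identityʳ k) (p′ ++ᵗ edge (Adj-sym G e) []) , moveEnds a b c b∷ws↭
  reverseᵗ {a} {c} (jump {b = b} {k = k} ¬e ≥n p) with ws , p′ , b∷ws↭ ← reverseᵗ p =
    ws ++ b ∷ [] , subst (λ k → Trail G c a k (ws ++ b ∷ [])) (+-comm k 1)
      (p′ ++ᵗ jump (¬e ∘ Adj-sym G) (≤-trans ≥n (≤-reflexive (+-comm (degree G a) (degree G b)))) []) , moveEnds a b c b∷ws↭

  record Jump (a c : Fin n) (k : ℕ) (vs : List (Fin n)) : Set where
    constructor mkJump
    field
      {x y}    : Fin n
      {k₁ k₂}  : ℕ
      {ws₁ ws₂} : List (Fin n)
      before   : Trail G a x k₁ ws₁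
      ¬adj     : ¬ Adj G x y
      large    : n ≤ degree G x + degree G y
      after    : Trail G y c k₂ ws₂
      k≡       : k ≡ k₁ + k₂
      vs≡      : vs ≡ ws₁ ++ x ∷ ws₂

  findJump : ∀ {a c k vs} → Trail G a c (suc k) vs → Jump a c k vs
  findJump (edge {a} e p) with mkJump before ¬adj large after k≡ vs≡ ← findJump p =
    mkJump (edge e before) ¬adj large after k≡ (cong (a ∷_) vs≡)
  findJump (jump ¬e ≥n p) = mkJump [] ¬e ≥n p refl refl

  -- The step from `x` to `y` is cut out. It may itself be a jump, hence the inequality in `k≥`.
  record Crossing (f g : Fin n → Bool) (a c : Fin n) (k : ℕ) (vs : List (Fin n)) : Set where
    constructor mkCrossing
    field
      {x y}    : Fin n
      {k₁ k₂}  : ℕ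
      {ws₁ ws₂} : List (Fin n)
      before   : Trail G a x k₁ ws₁
      gx       : g x ≡ true
      fy       : f y ≡ true
      after    : Trail G y c k₂ ws₂
      k≥       : k₁ + k₂ ≤ k
      vs≡      : vs ≡ ws₁ ++ x ∷ ws₂

  module _ (f g : Fin n → Bool) where

    private
      F Γ : List (Fin n) → ℕ
      F vs = sum (map ([_]ᵇ ∘ f) vs)
      Γ vs = sum (map ([_]ᵇ ∘ g) vs)

      crossHere : ∀ {a b c k k′ vs} → Trail G b c k′ vs → k′ ≤ k →
        Crossing f g a c k (a ∷ vs) ⊎ [ g a ]ᵇ + [ f b ]ᵇ ≤ 1
      crossHere {a} {b} q k′≤k with g a in ga | f b in fb
      ... | true  | true  = inj₁ (mkCrossing [] ga fb q k′≤k refl)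
      ... | true  | false = inj₂ ≤-refl
      ... | false | true  = inj₂ ≤-refl
      ... | false | false = inj₂ z≤n

      extendBound : ∀ a b c vs → [ g a ]ᵇ + [ f b ]ᵇ ≤ 1 →
        F vs + [ f c ]ᵇ + Γ vs ≤ length vs + [ f b ]ᵇ →
        F (a ∷ vs) + [ f c ]ᵇ + Γ (a ∷ vs) ≤ length (a ∷ vs) + [ f a ]ᵇ
      extendBound a b c vs le ih = begin
        [ f a ]ᵇ + F vs + [ f c ]ᵇ + ([ g a ]ᵇ + Γ vs)   ≡⟨ regroup [ f a ]ᵇ (F vs) [ f c ]ᵇ [ g a ]ᵇ (Γ vs) ⟩
        [ f a ]ᵇ + [ g a ]ᵇ + (F vs + [ f c ]ᵇ + Γ vs)   ≤⟨ +-monoʳ-≤ ([ f a ]ᵇ + [ g a ]ᵇ) ih ⟩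
        [ f a ]ᵇ + [ g a ]ᵇ + (length vs + [ f b ]ᵇ)     ≡⟨ regroup′ [ f a ]ᵇ [ g a ]ᵇ (length vs) [ f b ]ᵇ ⟩
        [ g a ]ᵇ + [ f b ]ᵇ + (length vs + [ f a ]ᵇ)     ≤⟨ +-monoˡ-≤ _ le ⟩
        suc (length vs) + [ f a ]ᵇ                       ∎
        where
        open ≤-Reasoning
        regroup : ∀ p q r s t → p + q + r + (s + t) ≡ p + s + (q + r + t)
        regroup = solve-∀
        regroup′ : ∀ p q r s → p + q + (r + s) ≡ q + s + (r + p)
        regroup′ = solve-∀

    -- A step that is no crossing contributes at most 1 to the number of starts satisfying `g` plus
    -- the number of ends satisfying `f`. The starts are `vs`; the ends are `vs` with `c` added and
    -- `a` removed, and the term for `a` stands on the right to avoid subtraction.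
    crossing : ∀ {a c k vs} → Trail G a c k vs →
      Crossing f g a c k vs ⊎ F vs + [ f c ]ᵇ + Γ vs ≤ length vs + [ f a ]ᵇ
    crossing [] = inj₂ (≤-reflexive (+-identityʳ _))
    crossing {a} {c} (edge {b = b} {vs = vs} e q) with crossing q
    ... | inj₁ (mkCrossing before gx fy after k≥ vs≡) =
      inj₁ (mkCrossing (edge e before) gx fy after k≥ (cong (a ∷_) vs≡))
    ... | inj₂ ih with crossHere {a} q ≤-refl
    ...   | inj₁ cr = inj₁ cr
    ...   | inj₂ le = inj₂ (extendBound a b c vs le ih)
    crossing {a} {c} (jump {b = b} {vs = vs} ¬e ≥n q) with crossing q
    ... | inj₁ (mkCrossing before gx fy after k≥ vs≡) =
      inj₁ (mkCrossing (jump ¬e ≥n before) gx fy after (s≤s k≥) (cong (a ∷_) vs≡))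
    ... | inj₂ ih with crossHere {a} q (n≤1+n _)
    ...   | inj₁ cr = inj₁ cr
    ...   | inj₂ le = inj₂ (extendBound a b c vs le ih)

  -- Each vertex is listed by the step leaving it, so a closed trail lists its base point once. On
  -- two vertices, an edge run through back and forth counts as a cycle.
  SpanningCycle : ℕ → Set
  SpanningCycle k = ∃[ a ] ∃[ vs ] Trail G a a k vs × vs ↭ allFin n

  -- Rotate the jump x y to the closing position and replace it, together with an edge of the
  -- path from y to x, by two edges of G; the degree condition provides the place for this.
  removeJump : ∀ {k} → SpanningCycle (suc k) → ∃[ k′ ] k′ ≤ k × SpanningCycle k′
  removeJump {k} (a , vs , p , vs↭)
    with mkJump {x} {y} {k₁} {k₂} {ws₁} {ws₂} before ¬xy large after k≡ refl ← findJump p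
    -- The trail `after ++ᵗ before` runs from `y` to `x` and lists every vertex but `x`. A crossing
    -- is a step from `z` to `w` with `z` adjacent to `x` and `w` adjacent to `y`.
    with crossing (adj G y) (adj G x) (after ++ᵗ before)
  -- Without a crossing the degrees of `x` and `y` add up to at most `length ws`, which is n - 1.
  ... | inj₂ bound = contradiction (begin-strict
      degree G x + degree G y
        ≡⟨ cong₂ _+_ (degree-over x) (degree-over y) ⟩
      (Γ ws + [ adj G x x ]ᵇ) + (F ws + [ adj G y x ]ᵇ)
        ≡⟨ cong (λ b → (Γ ws + [ b ]ᵇ) + (F ws + [ adj G y x ]ᵇ)) (irrefl G x) ⟩
      (Γ ws + 0) + (F ws + [ adj G y x ]ᵇ)
        ≡⟨ cong (_+ (F ws + [ adj G y x ]ᵇ)) (+-identityʳ (Γ ws)) ⟩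
      Γ ws + (F ws + [ adj G y x ]ᵇ)
        ≡⟨ +-comm (Γ ws) _ ⟩
      F ws + [ adj G y x ]ᵇ + Γ ws
        ≤⟨ bound ⟩
      length ws + [ adj G y y ]ᵇ
        ≡⟨ cong (λ b → length ws + [ b ]ᵇ) (irrefl G y) ⟩
      length ws + 0
        ≡⟨ +-identityʳ _ ⟩
      length ws
        <⟨ ≤-reflexive (trans (+-comm 1 (length ws)) (≡-sym (length-++ ws))) ⟩
      length (ws ++ x ∷ [])
        ≡⟨ ↭-length ws↭ ⟩
      length (allFin n)
        ≡⟨ length-tabulate {n = n} id ⟩
      n ∎) (≤⇒≯ large)
    where
    open ≤-Reasoning
    ws = ws₂ ++ ws₁
    F Γ : List (Fin n) → ℕ
    F vs = sum (map ([_]ᵇ ∘ adj G y) vs)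
    Γ vs = sum (map ([_]ᵇ ∘ adj G x) vs)
    ws↭ : ws ++ x ∷ [] ↭ allFin n
    ws↭ = ↭-trans (↭-trans (↭-sym (∷↭∷ʳ x ws)) (↭-trans (prep x (++-comm ws₂ ws₁)) (↭-sym (shift x ws₁ ws₂)))) vs↭
    degree-over : ∀ u → degree G u ≡ sum (map ([_]ᵇ ∘ adj G u) ws) + [ adj G u x ]ᵇ
    degree-over u = begin-equality
      degree G u                                        ≡⟨ sum-↭ (map⁺ ([_]ᵇ ∘ adj G u) ws↭) ⟨
      sum (map ([_]ᵇ ∘ adj G u) (ws ++ x ∷ []))          ≡⟨ cong sum (map-++ _ ws _) ⟩
      sum (map ([_]ᵇ ∘ adj G u) ws ++ [ adj G u x ]ᵇ ∷ []) ≡⟨ sum-++ (map ([_]ᵇ ∘ adj G u) ws) _ ⟩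
      sum (map ([_]ᵇ ∘ adj G u) ws) + ([ adj G u x ]ᵇ + 0) ≡⟨ cong (sum (map ([_]ᵇ ∘ adj G u) ws) +_) (+-identityʳ _) ⟩
      sum (map ([_]ᵇ ∘ adj G u) ws) + [ adj G u x ]ᵇ    ∎
  ... | inj₁ (mkCrossing {z} {w} {j₁} {j₂} {us₁} {us₂} first xz yw second j≤ ws≡)
    with us₃ , second′ , us₃↭ ← reverseᵗ second =
      j₁ + j₂
    , ≤-trans j≤ (≤-reflexive (trans (+-comm k₂ k₁) (≡-sym k≡)))
    -- The new cycle goes from `y` to `z`, over an edge to `x`, backwards to `w`, and over an edge
    -- to `y`.
    , y , us₁ ++ z ∷ us₃ ++ w ∷ []
    , subst (λ j → Trail G y y j (us₁ ++ z ∷ us₃ ++ w ∷ [])) (cong (j₁ +_) (+-identityʳ j₂))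
        (first ++ᵗ edge (Adj-sym G xz) (second′ ++ᵗ edge (Adj-sym G yw) []))
    , perm
    where
    perm : us₁ ++ z ∷ us₃ ++ w ∷ [] ↭ allFin n
    perm = ↭-trans (++⁺ˡ us₁ (prep z (↭-trans (↭-sym (∷↭∷ʳ w us₃)) us₃↭)))
      (↭-trans (++⁺ˡ us₁ (shift x (z ∷ []) us₂))
      (↭-trans (shift x us₁ (z ∷ us₂))
      (↭-trans (prep x (↭-trans (↭-reflexive (≡-sym ws≡)) (++-comm ws₂ ws₁)))
      (↭-trans (↭-sym (shift x ws₁ ws₂)) vs↭))))

  -- Recursion is on `bound` because one rerouting may remove more than one jump.
  removeJumps : ∀ bound {k} → k ≤ bound → SpanningCycle k → SpanningCycle 0
  removeJumps _           {zero}  _         c = c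
  removeJumps (suc bound) {suc k} (s≤s k≤) c with _ , k′≤k , c′ ← removeJump c =
    removeJumps bound (≤-trans k′≤k k≤) c′

-- Hamiltonicity of closures and of complete graphs.

Hamiltonian : Graph n → Set
Hamiltonian G = SpanningCycle {G = G} 0

-- An edge added by the closure joins vertices of degree sum at least n, which is what a jump
-- requires.
openJumps : (G : Graph n) → ∀ {a b vs} → Trail (closure G) a b 0 vs → ∃[ k ] Trail G a b k vs
openJumps G [] = 0 , []
openJumps G (edge {a} {b} e p) with _ , q ← openJumps G p | closure⁻ G {a} {b} e
... | inj₁ ab       = _ , edge ab q
-- The second case of `Joinable` does not exclude an edge of `G`, so adjacency is decided before a
-- jump is counted.
... | inj₂ (_ , ≥n) with Adj? G a b
...   | yes ab = _ , edge ab q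
...   | no ¬ab = _ , jump ¬ab ≥n q

closure-Hamiltonian : (G : Graph n) → Hamiltonian (closure G) → Hamiltonian G
closure-Hamiltonian G (a , vs , p , vs↭) with k , q ← openJumps G p =
  removeJumps k ≤-refl (a , vs , q , vs↭)

complete-Hamiltonian : (G : Graph (2 + n)) → (∀ {u v} → u ≢ v → Adj G u v) → Hamiltonian G
complete-Hamiltonian {n} G complete with allFin⁺ (2 + n)
... | (0≢1 ∷ 0≢) ∷ unique = zero , allFin (2 + n) , edge (complete 0≢1) (close (suc zero) _ unique 0≢ 0≢1) , ↭-refl
  where
  close : ∀ x xs → Unique (x ∷ xs) → All (zero ≢_) xs → zero ≢ x → Trail G x zero 0 (x ∷ xs)
  close x []       _                   _            0≢x = edge (complete (0≢x ∘ ≡-sym)) []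
  close x (y ∷ ys) ((x≢y ∷ _) ∷ uniq) (0≢y ∷ 0≢ys) _   = edge (complete x≢y) (close y ys uniq 0≢ys 0≢y)

-- Growth of degree sums, and non-adjacent pairs of maximal degree sum.

∑-mono-< : ∀ {f g : Fin n → ℕ} → (∀ u → f u ≤ g u) → ∀ v → f v < g v → ∑ f < ∑ g
∑-mono-< {n} {f} {g} f≤g v fv<gv = begin
  suc (∑ f)               ≡⟨ +-comm 1 (∑ f) ⟩
  ∑ f + 1                 ≡⟨ cong (∑ f +_) (∑-δ v) ⟨
  ∑ f + ∑ (δ v)           ≡⟨ sum-map-+ f (δ v) (allFin n) ⟨
  ∑ (λ u → f u + δ v u)   ≤⟨ sum-map-mono bumped (allFin n) ⟩
  ∑ g                     ∎
  where
  open ≤-Reasoning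
  bumped : ∀ u → f u + δ v u ≤ g u
  bumped u with u Fin.≟ v
  ... | yes refl = ≤-trans (≤-reflexive (+-comm (f u) 1)) fv<gv
  ... | no _     = ≤-trans (≤-reflexive (+-identityʳ (f u))) (f≤g u)

∑-1 : ∑ {n} (λ _ → 1) ≡ n
∑-1 {n} = trans (∑-const {n} 1) (*-identityʳ n)

degree<n : (G : Graph n) (u : Fin n) → degree G u < n
degree<n {n} G u = subst (degree G u <_) (∑-1 {n})
  (∑-mono-< (λ v → []ᵇ≤1 (adj G u v)) u (≤-reflexive (cong (suc ∘ [_]ᵇ) (irrefl G u))))

-- Limits the number of closure rounds that add an edge.
degreeSum≤n*n : (G : Graph n) → degreeSum G ≤ n * n
degreeSum≤n*n {n} G = ≤-trans (sum-map-mono (λ u → <⇒≤ (degree<n G u)) (allFin n)) (≤-reflexive (∑-const {n} n))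

[]ᵇ-mono : ∀ {a b} → (a ≡ true → b ≡ true) → [ a ]ᵇ ≤ [ b ]ᵇ
[]ᵇ-mono {false} a⇒b = z≤n
[]ᵇ-mono {true}  a⇒b = ≤-reflexive (cong [_]ᵇ (≡-sym (a⇒b refl)))

module _ (G : Graph n) where

  degree-closure : ∀ u → degree G u ≤ degree (closure G) u
  degree-closure u = sum-map-mono (λ v → []ᵇ-mono (λ uv → closure⁺ G {u} {v} (inj₁ uv))) (allFin n)

  NonEdge : Fin n → Fin n → Set
  NonEdge u v = u ≢ v × ¬ Adj G u v

  NonEdge? : Decidable NonEdge
  NonEdge? u v = ¬? (u Fin.≟ v) ×-dec ¬? (Adj? G u v)

  degreeSum-closure : degreeSum G ≤ degreeSum (closure G)
  degreeSum-closure = sum-map-mono degree-closure (allFin n)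

  degreeSum-closure-< : ∀ {x y} → NonEdge x y → n ≤ degree G x + degree G y →
    degreeSum G < degreeSum (closure G)
  degreeSum-closure-< {x} {y} (x≢y , ¬xy) ≥n = ∑-mono-< degree-closure x
    (∑-mono-< (λ v → []ᵇ-mono (λ uv → closure⁺ G {x} {v} (inj₁ uv))) y gain)
    where
    gain : [ adj G x y ]ᵇ < [ adj (closure G) x y ]ᵇ
    gain rewrite closure⁺ G {x} {y} (inj₂ (x≢y , ≥n)) | Bool.¬-not ¬xy = ≤-refl

  degreeOf₂ : Fin n → Fin n → ℕ
  degreeOf₂ x y = degree G x + degree G y

  IsMaximal : Fin n → Fin n → Set
  IsMaximal u v = ∀ {x y} → NonEdge x y → degreeOf₂ x y ≤ degreeOf₂ u v

  -- As long as some non-adjacent pair has a larger degree sum, move to it. The sums increase and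
  -- stay below n, so n rounds of search suffice.
  maximalNonEdge : (∀ {x y} → NonEdge x y → degreeOf₂ x y < n) →
    ∀ {x y} → NonEdge x y → ∃[ u ] ∃[ v ] NonEdge u v × IsMaximal u v
  maximalNonEdge small {x} {y} ne = search n ne (m≤n+m n _)
    where
    search : ∀ fuel {x y} → NonEdge x y → n ≤ degreeOf₂ x y + fuel →
      ∃[ u ] ∃[ v ] NonEdge u v × IsMaximal u v
    search zero       ne n≤ = contradiction (≤-trans n≤ (≤-reflexive (+-identityʳ _))) (<⇒≱ (small ne))
    search (suc fuel) {x} {y} ne n≤
      with Fin.any? (λ u → Fin.any? (λ v → NonEdge? u v ×-dec (degreeOf₂ x y <? degreeOf₂ u v)))
    ... | yes (u , v , ne′ , larger) =
      search fuel ne′ (≤-trans n≤ (≤-trans (≤-reflexive (+-suc _ fuel)) (+-monoˡ-≤ fuel larger)))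
    ... | no ¬larger = x , y , ne , λ {u} {v} ne′ → ≮⇒≥ (λ larger → ¬larger (u , v , ne′ , larger))

-- Erdős' bound on the degree sum.

-- With n = 1 + 2h + m this is (n - h)(n - h - 1) + 2h², twice the number of edges of the
-- extremal graph K_h ∨ (K_{n-2h} ∪ h K_1).
erdősBound : ℕ → ℕ → ℕ
erdősBound h m = (h + m + 1) * (h + m) + 2 * (h * h)

module _ (G : Graph n) where

  -- Charge `h` to every vertex, a further `h` to each neighbour of `u`, and a further `m` to `v`
  -- and each neighbour of `v`. By maximality the charge covers each degree: at most `h` off the
  -- neighbours of `v`, at most d(v) ≤ h + m off those of `u`, at most n - 1 = 2h + m in any case.
  -- The charges total nh + h² + (d(v) + 1)m.
  degreeSum-bound : ∀ {u v} → NonEdge G u v → IsMaximal G u v → degree G u ≤ degree G v →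
    degree G u + degree G v < n →
    ∃[ m ] n ≡ suc (2 * degree G u + m) × degreeSum G ≤ erdősBound (degree G u) m
  degreeSum-bound {u} {v} (u≢v , ¬uv) maximal du≤dv small
    -- From h ≤ d(v) and h + d(v) < n follows 1 + 2h ≤ n; `m` is the slack.
    with m , n≡ ← m≤n⇒∃[o]m+o≡n
      (≤-trans (≤-trans (s≤s (≤-reflexive (cong (degree G u +_) (+-identityʳ _)))) (s≤s (+-monoʳ-≤ (degree G u) du≤dv))) small)
    = m , ≡-sym n≡ , (begin
      degreeSum G
        ≤⟨ sum-map-mono (pointwise m (≡-sym n≡)) V ⟩
      ∑ (λ w → h + [ adj G u w ]ᵇ * h + ([ adj G v w ]ᵇ + δ v w) * m)
        ≡⟨ sum-map-+ (λ w → h + [ adj G u w ]ᵇ * h) _ V ⟩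
      ∑ (λ w → h + [ adj G u w ]ᵇ * h) + ∑ (λ w → ([ adj G v w ]ᵇ + δ v w) * m)
        ≡⟨ cong₂ _+_ (trans (sum-map-+ (λ _ → h) _ V) (cong₂ _+_ (∑-const {n} h) (sum-map-* ([_]ᵇ ∘ adj G u) h V)))
                     (trans (sum-map-* (λ w → [ adj G v w ]ᵇ + δ v w) m V) (cong (_* m) (sum-map-+ ([_]ᵇ ∘ adj G v) (δ v) V))) ⟩
      n * h + h * h + (degree G v + ∑ (δ v)) * m
        ≤⟨ +-monoʳ-≤ (n * h + h * h) (*-monoˡ-≤ m (+-mono-≤ (dv≤ m (≡-sym n≡)) (≤-reflexive (∑-δ v)))) ⟩
      n * h + h * h + (h + m + 1) * m
        ≡⟨ cong (λ k → k * h + h * h + (h + m + 1) * m) n≡ ⟨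
      suc (2 * h + m) * h + h * h + (h + m + 1) * m
        ≡⟨ expand h m ⟩
      erdősBound h m ∎)
    where
    open ≤-Reasoning
    V = allFin n
    h = degree G u
    expand : ∀ h m → suc (2 * h + m) * h + h * h + (h + m + 1) * m ≡ (h + m + 1) * (h + m) + 2 * (h * h)
    expand = solve-∀
    double : ∀ h m → 2 * h + m ≡ h + (h + m)
    double = solve-∀
    dv≤ : ∀ m → n ≡ suc (2 * h + m) → degree G v ≤ h + m
    dv≤ m n≡ = +-cancelˡ-≤ h _ _ (≤-trans (s≤s⁻¹ (≤-trans small (≤-reflexive n≡))) (≤-reflexive (double h m)))
    pointwise : ∀ m → n ≡ suc (2 * h + m) → ∀ w →
      degree G w ≤ h + [ adj G u w ]ᵇ * h + ([ adj G v w ]ᵇ + δ v w) * m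
    pointwise m n≡ w with w Fin.≟ v
    ... | yes refl = ≤-trans (dv≤ m n≡) (+-mono-≤ (m≤m+n h _) (≤-trans (≤-reflexive (≡-sym (*-identityˡ m))) (*-monoˡ-≤ m (m≤n+m 1 [ adj G v w ]ᵇ))))
    ... | no w≢v with Adj? G v w
    ...   | no ¬vw = ≤-trans (+-cancelʳ-≤ (degree G v) _ _ (≤-trans (≤-reflexive (+-comm _ (degree G v))) (maximal (w≢v ∘ ≡-sym , ¬vw))))
                       (≤-trans (m≤m+n h _) (m≤m+n _ _))
    ...   | yes vw rewrite vw with w Fin.≟ u
    ...     | yes refl = ≤-trans (m≤m+n h _) (m≤m+n _ _)
    ...     | no w≢u with Adj? G u w
    ...       | yes uw rewrite uw = ≤-trans (s≤s⁻¹ (≤-trans (degree<n G w) (≤-reflexive n≡))) (≤-reflexive (regroup h m))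
      where
      regroup : ∀ h m → 2 * h + m ≡ h + 1 * h + (1 + 0) * m
      regroup = solve-∀
    ...       | no ¬uw = ≤-trans (+-cancelˡ-≤ h _ _ (maximal (w≢u ∘ ≡-sym , ¬uw)))
                           (≤-trans (dv≤ m n≡) (+-mono-≤ (m≤m+n h _) (≤-reflexive (≡-sym (*-identityˡ m)))))

  maximal-bound : ∀ {u v} → NonEdge G u v → IsMaximal G u v → degree G u + degree G v < n →
    ∃[ w ] ∃[ m ] n ≡ suc (2 * degree G w + m) × degreeSum G ≤ erdősBound (degree G w) m
  maximal-bound {u} {v} ne@(u≢v , ¬uv) maximal small with ≤-total (degree G u) (degree G v)
  ... | inj₁ u≤v = u , degreeSum-bound ne maximal u≤v small
  ... | inj₂ v≤u = v , degreeSum-bound (u≢v ∘ ≡-sym , ¬uv ∘ Adj-sym G)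
    (λ ne′ → ≤-trans (maximal ne′) (≤-reflexive (+-comm (degree G u) (degree G v)))) v≤u
    (≤-<-trans (≤-reflexive (+-comm (degree G v) (degree G u))) small)

-- Erdős' theorem, with the maximum over h replaced by a hypothesis for each h.
erdős : ∀ {n} → 2 ≤ n → (G : Graph n) → ∀ t → minDegree≥ G t →
  (∀ h m → t ≤ h → n ≡ suc (2 * h + m) → erdősBound h m < degreeSum G) → Hamiltonian G
-- The fuel covers the gap between the degree sum and n * n. Each closure round raises the degree
-- sum, and both hypotheses survive because degrees only grow.
erdős {n} 2≤n G t = go (n * n) G (m≤n+m (n * n) (degreeSum G))
  where
  go : ∀ fuel (G : Graph n) → n * n ≤ degreeSum G + fuel → minDegree≥ G t →
    (∀ h m → t ≤ h → n ≡ suc (2 * h + m) → erdősBound h m < degreeSum G) → Hamiltonian G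
  go fuel G enough minDeg large
    with Fin.any? (λ x → Fin.any? (λ y → NonEdge? G x y ×-dec (n ≤? degree G x + degree G y)))
  go zero G enough minDeg large | yes (x , y , ne , ≥n) =
    contradiction (≤-trans (degreeSum-closure-< G ne ≥n) (degreeSum≤n*n (closure G)))
      (≤⇒≯ (≤-trans enough (≤-reflexive (+-identityʳ _))))
  go (suc fuel) G enough minDeg large | yes (x , y , ne , ≥n) = closure-Hamiltonian G
    (go fuel (closure G)
      (≤-trans enough (≤-trans (≤-reflexive (+-suc _ fuel)) (+-monoˡ-≤ fuel (degreeSum-closure-< G ne ≥n))))
      (λ u → ≤-trans (minDeg u) (degree-closure G u))
      (λ h m t≤h n≡ → <-≤-trans (large h m t≤h n≡) (degreeSum-closure G)))
  -- From here on `G` is closed: non-adjacent pairs have degree sum below n.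
  go fuel G enough minDeg large | no ¬joinable with Fin.any? (λ x → Fin.any? (NonEdge? G x))
  ... | no ¬ne = complete n 2≤n G λ {u} {v} u≢v →
      decidable-stable (Adj? G u v) (λ ¬uv → ¬ne (u , v , u≢v , ¬uv))
    where
    complete : ∀ n → 2 ≤ n → (G : Graph n) → (∀ {u v} → u ≢ v → Adj G u v) → Hamiltonian G
    complete (suc (suc n)) _ = complete-Hamiltonian
    complete (suc zero) (s≤s ())
  ... | yes (x , y , ne) with maximalNonEdge G small ne
    where
    small : ∀ {x y} → NonEdge G x y → degreeOf₂ G x y < n
    small {x} {y} ne = ≰⇒> (λ ≥n → ¬joinable (x , y , ne , ≥n))
  ...   | u , v , ne′ , maximal
    with w , m , n≡ , bound ← maximal-bound G ne′ maximal (≰⇒> λ ≥n → ¬joinable (u , v , ne′ , ≥n)) =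
    contradiction (large _ m (minDeg w) n≡) (≤⇒≯ bound)

-- Comparing the edge hypotheses with Erdős' bound.

2*[1+n]C2 : ∀ n → 2 * (suc n C 2) ≡ suc n * n
2*[1+n]C2 zero    = refl
2*[1+n]C2 (suc n) = begin
  2 * (suc (suc n) C 2)              ≡⟨ cong (2 *_) (nCk+nC[k+1]≡[n+1]C[k+1] (suc n) 1) ⟨
  2 * (suc n C 1 + suc n C 2)        ≡⟨ cong (λ k → 2 * (k + suc n C 2)) (nC1≡n (suc n)) ⟩
  2 * (suc n + suc n C 2)            ≡⟨ *-distribˡ-+ 2 (suc n) _ ⟩
  2 * suc n + 2 * (suc n C 2)        ≡⟨ cong (2 * suc n +_) (2*[1+n]C2 n) ⟩
  2 * suc n + suc n * n              ≡⟨ factor n ⟩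
  suc (suc n) * suc n                ∎
  where
  open ≡-Reasoning
  factor : ∀ n → 2 * suc n + suc n * n ≡ suc (suc n) * suc n
  factor = solve-∀

2ab≤a²+b² : ∀ a b → 2 * (a * b) ≤ a * a + b * b
2ab≤a²+b² a b with ≤-total a b
... | inj₁ a≤b with k , refl ← m≤n⇒∃[o]m+o≡n a≤b = ≤-trans (m≤m+n _ (k * k)) (≤-reflexive (square a k))
  where
  square : ∀ a k → 2 * (a * (a + k)) + k * k ≡ a * a + (a + k) * (a + k)
  square = solve-∀
... | inj₂ b≤a with k , refl ← m≤n⇒∃[o]m+o≡n b≤a = ≤-trans (m≤m+n _ (k * k)) (≤-reflexive (square b k))
  where
  square : ∀ b k → 2 * ((b + k) * b) + k * k ≡ (b + k) * (b + k) + b * b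
  square = solve-∀

-- Below, h = t + d and n = 1 + 2h + m, so that n - t = 1 + (t + 2d + m).

2*[n∸t]C2 : ∀ t d m → 2 * ((suc (2 * (t + d) + m) ∸ t) C 2) ≡ suc (t + 2 * d + m) * (t + 2 * d + m)
2*[n∸t]C2 t d m = trans (cong (λ k → 2 * (k C 2)) (trans (cong (_∸ t) (split t d m)) (m+n∸m≡n t _)))
  (2*[1+n]C2 (t + 2 * d + m))
  where
  split : ∀ t d m → suc (2 * (t + d) + m) ≡ t + suc (t + 2 * d + m)
  split = solve-∀

-- The right side exceeds the left by (t - d)² + 2md + d + t.
middle-bound : ∀ t d m → erdősBound (t + d) m ≤ suc (t + 2 * d + m) * (t + 2 * d + m) + 3 * t * t + t
middle-bound t d m = begin
  erdősBound (t + d) m             ≡⟨ lhs t d m ⟩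
  X + 2 * (t * d)                  ≤⟨ +-monoʳ-≤ X (≤-trans (2ab≤a²+b² t d) (m≤m+n _ (2 * (m * d) + d + t))) ⟩
  X + (t * t + d * d + (2 * (m * d) + d + t)) ≡⟨ rhs t d m ⟩
  suc (t + 2 * d + m) * (t + 2 * d + m) + 3 * t * t + t ∎
  where
  open ≤-Reasoning
  X = (t + d + m + 1) * (t + d + m) + 2 * (t * t) + 2 * (t * d) + 2 * (d * d)
  lhs : ∀ t d m → (t + d + m + 1) * (t + d + m) + 2 * ((t + d) * (t + d)) ≡
    (t + d + m + 1) * (t + d + m) + 2 * (t * t) + 2 * (t * d) + 2 * (d * d) + 2 * (t * d)
  lhs = solve-∀
  rhs : ∀ t d m → (t + d + m + 1) * (t + d + m) + 2 * (t * t) + 2 * (t * d) + 2 * (d * d) + (t * t + d * d + (2 * (m * d) + d + t))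
    ≡ suc (t + 2 * d + m) * (t + 2 * d + m) + 3 * t * t + t
  rhs = solve-∀

-- The difference of the two sides is (t - d - 1)² + (2m - 1)d, which leaves only m = 0 with d
-- positive in doubt. There n = 5 forces t = d = 1, where equality holds, and n ≥ 6t + 1 gives d ≥
-- 2t.
outer-core : ∀ t d m → 1 ≤ t → (let n = suc (2 * (t + d) + m) in n ≡ 5 ⊎ 6 * t + 1 ≤ n) →
  2 * (t * d) + 2 * t ≤ t * t + d * d + 2 * (m * d) + d + 1
outer-core t zero m _ _ = begin
  2 * (t * 0) + 2 * t                      ≡⟨ lhs t ⟩
  2 * (t * 1)                              ≤⟨ 2ab≤a²+b² t 1 ⟩
  t * t + 1                                ≤⟨ m≤m+n _ (2 * (m * 0)) ⟩
  t * t + 1 + 2 * (m * 0)                  ≡⟨ rhs t m ⟩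
  t * t + 0 + 2 * (m * 0) + 0 + 1          ∎
  where
  open ≤-Reasoning
  lhs : ∀ t → 2 * (t * 0) + 2 * t ≡ 2 * (t * 1)
  lhs = solve-∀
  rhs : ∀ t m → t * t + 1 + 2 * (m * 0) ≡ t * t + 0 + 2 * (m * 0) + 0 + 1
  rhs = solve-∀
outer-core t d (suc m) _ _ = begin
  2 * (t * d) + 2 * t                           ≡⟨ lhs t d ⟩
  2 * (t * suc d)                               ≤⟨ 2ab≤a²+b² t (suc d) ⟩
  t * t + suc d * suc d                         ≤⟨ m≤m+n _ (2 * (m * d) + d) ⟩
  t * t + suc d * suc d + (2 * (m * d) + d)     ≡⟨ rhs t d m ⟩
  t * t + d * d + 2 * (suc m * d) + d + 1       ∎
  where
  open ≤-Reasoning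
  lhs : ∀ t d → 2 * (t * d) + 2 * t ≡ 2 * (t * suc d)
  lhs = solve-∀
  rhs : ∀ t d m → t * t + suc d * suc d + (2 * (m * d) + d) ≡ t * t + d * d + 2 * (suc m * d) + d + 1
  rhs = solve-∀
outer-core (suc t) (suc d) zero _ (inj₁ n≡5) = tight t d
  (m+n≡0⇒m≡0 (t + d) (+-cancelˡ-≡ 5 _ _ (trans (≡-sym (split t d)) n≡5)))
  where
  split : ∀ t d → suc (2 * (suc t + suc d) + 0) ≡ 5 + 2 * (t + d)
  split = solve-∀
  tight : ∀ t d → t + d ≡ 0 →
    2 * (suc t * suc d) + 2 * suc t ≤ suc t * suc t + suc d * suc d + 0 + suc d + 1
  tight zero zero _ = ≤-refl
outer-core t d@(suc _) zero _ (inj₂ 6t<n) = begin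
  2 * (t * d) + 2 * t                ≡⟨ lhs t d ⟩
  2 * t * d + 2 * t                  ≤⟨ +-mono-≤ (*-monoˡ-≤ d 2t≤d) 2t≤d ⟩
  d * d + d                          ≤⟨ m≤n+m _ (t * t + 1) ⟩
  t * t + 1 + (d * d + d)            ≡⟨ rhs t d ⟩
  t * t + d * d + 0 + d + 1          ∎
  where
  open ≤-Reasoning
  lhs : ∀ t d → 2 * (t * d) + 2 * t ≡ 2 * t * d + 2 * t
  lhs = solve-∀
  rhs : ∀ t d → t * t + 1 + (d * d + d) ≡ t * t + d * d + 0 + d + 1
  rhs = solve-∀
  left : ∀ t → 6 * t + 1 ≡ suc (2 * t) + 2 * (2 * t)
  left = solve-∀
  right : ∀ t d → suc (2 * (t + d) + 0) ≡ suc (2 * t) + 2 * d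
  right = solve-∀
  2t≤d : 2 * t ≤ d
  2t≤d = *-cancelˡ-≤ 2 (+-cancelˡ-≤ (suc (2 * t)) _ _
    (≤-trans (≤-reflexive (≡-sym (left t))) (≤-trans 6t<n (≤-reflexive (right t d)))))

-- Cancelling the common part `X` leaves `outer-core`. The term 2t stands on the left instead of
-- being subtracted on the right.
outer-bound : ∀ t d m → 1 ≤ t → (let n = suc (2 * (t + d) + m) in n ≡ 5 ⊎ 6 * t + 1 ≤ n) →
  erdősBound (t + d) m + 2 * t ≤ suc (t + 2 * d + m) * (t + 2 * d + m) + 3 * t * t + 1
outer-bound t d m 1≤t range = begin
  erdősBound (t + d) m + 2 * t           ≡⟨ lhs t d m ⟩
  X + (2 * (t * d) + 2 * t)              ≤⟨ +-monoʳ-≤ X (outer-core t d m 1≤t range) ⟩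
  X + (t * t + d * d + 2 * (m * d) + d + 1) ≡⟨ rhs t d m ⟩
  suc (t + 2 * d + m) * (t + 2 * d + m) + 3 * t * t + 1 ∎
  where
  open ≤-Reasoning
  X = (t + d + m + 1) * (t + d + m) + 2 * (t * t) + 2 * (t * d) + 2 * (d * d)
  lhs : ∀ t d m → (t + d + m + 1) * (t + d + m) + 2 * ((t + d) * (t + d)) + 2 * t ≡
    (t + d + m + 1) * (t + d + m) + 2 * (t * t) + 2 * (t * d) + 2 * (d * d) + (2 * (t * d) + 2 * t)
  lhs = solve-∀
  rhs : ∀ t d m → (t + d + m + 1) * (t + d + m) + 2 * (t * t) + 2 * (t * d) + 2 * (d * d) + (t * t + d * d + 2 * (m * d) + d + 1)
    ≡ suc (t + 2 * d + m) * (t + 2 * d + m) + 3 * t * t + 1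
  rhs = solve-∀

-- With h = t + d, the ranges n = 5, 6 ≤ n ≤ 6t and n ≥ 6t + 1 exhaust n ≥ 5, and each has its own
-- comparison above.
edgeBound⇒erdősBound : ∀ t n e → 1 ≤ t → 5 ≤ n →
  (n ≡ 5 ⊎ 6 * t + 1 ≤ n → 2 * ((n ∸ t) C 2) + 3 * t * t + 1 < 2 * e + 2 * t) →
  (6 ≤ n × n ≤ 6 * t → 2 * ((n ∸ t) C 2) + 3 * t * t + t < 2 * e) →
  ∀ h m → t ≤ h → n ≡ suc (2 * h + m) → erdősBound h m < 2 * e
edgeBound⇒erdősBound t n e 1≤t 5≤n outer middle h m t≤h n≡ = go (h ∸ t) (≡-sym (m+[n∸m]≡n t≤h))
  where
  module _ (d : ℕ) (h≡ : h ≡ t + d) where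

    2*C : 2 * ((n ∸ t) C 2) ≡ suc (t + 2 * d + m) * (t + 2 * d + m)
    2*C = trans (cong (λ k → 2 * ((k ∸ t) C 2)) (trans n≡ (cong (λ k → suc (2 * k + m)) h≡))) (2*[n∸t]C2 t d m)

    viaOuter : n ≡ 5 ⊎ 6 * t + 1 ≤ n → erdősBound h m < 2 * e
    viaOuter range = +-cancelʳ-< (2 * t) _ _ (≤-<-trans
      (≤-trans (subst₂ (λ h n → n ≡ 5 ⊎ 6 * t + 1 ≤ n → erdősBound h m + 2 * t ≤ _)
                 (≡-sym h≡) (≡-sym (trans n≡ (cong (λ k → suc (2 * k + m)) h≡))) (outer-bound t d m 1≤t) range)
        (≤-reflexive (cong (λ c → c + 3 * t * t + 1) (≡-sym 2*C))))
      (outer range))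

    go : erdősBound h m < 2 * e
    go with m≤n⇒m<n∨m≡n 5≤n | n ≤? 6 * t
    ... | inj₁ 6≤n | yes n≤6t = ≤-<-trans
      (≤-trans (subst (λ h → erdősBound h m ≤ _) (≡-sym h≡) (middle-bound t d m))
        (≤-reflexive (cong (λ c → c + 3 * t * t + t) (≡-sym 2*C))))
      (middle (6≤n , n≤6t))
    ... | inj₁ _   | no n≰6t = viaOuter (inj₂ (≤-trans (≤-reflexive (+-comm (6 * t) 1)) (≰⇒> n≰6t)))
    ... | inj₂ 5≡n | _       = viaOuter (inj₁ (≡-sym 5≡n))

-- Path graphs as trees, and their leaves.

distinctNeighbours⇒2≤degree : (G : Graph n) {u v w : Fin n} → v ≢ w → Adj G u v → Adj G u w → 2 ≤ degree G u
distinctNeighbours⇒2≤degree {n} G {u} {v} {w} v≢w uv uw = begin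
  1 + 1                         ≡⟨ cong₂ _+_ (∑-δ v) (∑-δ w) ⟨
  ∑ (δ v) + ∑ (δ w)             ≡⟨ sum-map-+ (δ v) (δ w) (allFin n) ⟨
  ∑ (λ x → δ v x + δ w x)       ≤⟨ sum-map-mono pointwise (allFin n) ⟩
  degree G u                    ∎
  where
  open ≤-Reasoning
  pointwise : ∀ x → δ v x + δ w x ≤ [ adj G u x ]ᵇ
  pointwise x with x Fin.≟ v | x Fin.≟ w
  ... | yes refl | yes refl = contradiction refl v≢w
  ... | yes refl | no _     = ≤-reflexive (≡-sym (cong [_]ᵇ uv))
  ... | no _     | yes refl = ≤-reflexive (≡-sym (cong [_]ᵇ uw))
  ... | no _     | no _     = z≤n

-- The parameters enumerate the vertices: `pos` is a bijection onto the numbers below n, with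
-- inverse `at`.
module Path {n : ℕ} (pos : Fin n → ℕ) (pos-injective : ∀ {u v} → pos u ≡ pos v → u ≡ v)
  (pos<n : ∀ u → pos u < n) (at : ∀ {i} → i < n → Fin n) (pos-at : ∀ {i} (i<n : i < n) → pos (at i<n) ≡ i) where

  Consecutive : Fin n → Fin n → Set
  Consecutive u v = pos v ≡ suc (pos u) ⊎ pos u ≡ suc (pos v)

  Consecutive? : Decidable Consecutive
  Consecutive? u v = (pos v ≟ suc (pos u)) ⊎-dec (pos u ≟ suc (pos v))

  Consecutive-irrefl : ∀ u → ¬ Consecutive u u
  Consecutive-irrefl u (inj₁ e) = 1+n≢n (≡-sym e)
  Consecutive-irrefl u (inj₂ e) = 1+n≢n (≡-sym e)

  path : Graph n
  path = fromRelation Consecutive? swap Consecutive-irrefl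

  path⁺ : ∀ {u v} → Consecutive u v → Adj path u v
  path⁺ {u} {v} = fromRelation⁺ Consecutive? swap Consecutive-irrefl {u} {v}

  path⁻ : ∀ {u v} → Adj path u v → Consecutive u v
  path⁻ {u} {v} = fromRelation⁻ Consecutive? swap Consecutive-irrefl {u} {v}

  path-connected : Connected path
  path-connected u v with ≤-total (pos u) (pos v)
  ... | inj₁ u≤v = _ , walkUp (pos v ∸ pos u) (≡-sym (m∸n+n≡m u≤v))
    where
    walkUp : ∀ k {u} → pos v ≡ k + pos u → Walk path u v k
    walkUp zero    e with refl ← pos-injective e = nil
    walkUp (suc k) {u} e = cons (path⁺ {u} {at next<n} (inj₁ (pos-at next<n)))
      (walkUp k (trans e (trans (≡-sym (+-suc k (pos u))) (cong (k +_) (≡-sym (pos-at next<n))))))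
      where
      next<n : suc (pos u) < n
      next<n = ≤-<-trans (≤-trans (s≤s (m≤n+m (pos u) k)) (≤-reflexive (≡-sym e))) (pos<n v)
  ... | inj₂ v≤u = _ , walkDown (pos u ∸ pos v) (≡-sym (m∸n+n≡m v≤u))
    where
    walkDown : ∀ k {u} → pos u ≡ k + pos v → Walk path u v k
    walkDown zero    e with refl ← pos-injective e = nil
    walkDown (suc k) {u} e = cons (path⁺ {u} {at next<n} (inj₂ (trans e (cong suc (≡-sym (pos-at next<n))))))
      (walkDown k (pos-at next<n))
      where
      next<n : k + pos v < n
      next<n = <-trans (≤-reflexive (≡-sym e)) (pos<n u)

  -- A path of the graph cannot turn back, so the position changes monotonically along it.
  ascending : ∀ {x y zs} → Unique (x ∷ y ∷ zs) → Linked (Adj path) (y ∷ zs) →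
    pos y ≡ suc (pos x) → pos (lastOf y zs) ≡ suc (length zs + pos x)
  ascending {zs = []}     _ _ up = up
  ascending {x} {y} {z ∷ zs} ((_ ∷ x≢z ∷ _) ∷ uniq) (yz ∷ linked) up with path⁻ {y} {z} yz
  ... | inj₁ up′  = trans (ascending uniq linked up′)
    (cong suc (trans (cong (length zs +_) up) (+-suc (length zs) (pos x))))
  ... | inj₂ down = contradiction (pos-injective (suc-injective (trans (≡-sym up) down))) x≢z

  descending : ∀ {x y zs} → Unique (x ∷ y ∷ zs) → Linked (Adj path) (y ∷ zs) →
    pos x ≡ suc (pos y) → pos x ≡ suc (length zs + pos (lastOf y zs))
  descending {zs = []}     _ _ down = down
  descending {x} {y} {z ∷ zs} ((_ ∷ x≢z ∷ _) ∷ uniq) (yz ∷ linked) down with path⁻ {y} {z} yz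
  ... | inj₁ up    = contradiction (pos-injective (trans down (≡-sym up))) x≢z
  ... | inj₂ down′ = trans down (cong suc (descending uniq linked down′))

  private
    farApart : ∀ {k a b : ℕ} → b ≡ suc (suc k + a) → ¬ (b ≡ suc a ⊎ a ≡ suc b)
    farApart {k} {a} refl (inj₁ e) = m≢1+n+m a {k} (≡-sym (suc-injective e))
    farApart {k} {a} refl (inj₂ e) = m≢1+n+m a {suc (suc k)} e

  -- A cycle keeps the direction of its first step, so with three or more vertices its last position
  -- is at least two away from its first and no edge closes it.
  path-acyclic : Acyclic path
  path-acyclic (x ∷ y ∷ []) (s≤s (s≤s ()) , _)
  path-acyclic (x ∷ y ∷ z ∷ zs) (_ , uniq , xy ∷ linked , close)
    with path⁻ {x} {y} xy | path⁻ {lastOf z zs} {x} close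
  ... | inj₁ up   | close′ = farApart (ascending uniq linked up) (swap close′)
  ... | inj₂ down | close′ = farApart (descending uniq linked down) close′

  path-isTree : IsTree path
  path-isTree = path-connected , path-acyclic

  -- Each step changes the position by one.
  walk-length : ∀ {u v k} → Walk path u v k → pos u ≤ k + pos v × pos v ≤ k + pos u
  walk-length nil = ≤-refl , ≤-refl
  walk-length {u} (cons {v = w} {w = v} {k = k} uw walk) with down , up ← walk-length walk | path⁻ {u} {w} uw
  ... | inj₁ e = ≤-trans (n≤1+n _) (≤-trans (≤-reflexive (≡-sym e)) (m≤n⇒m≤1+n down))
               , ≤-trans up (≤-reflexive (trans (cong (k +_) e) (+-suc k (pos u))))
  ... | inj₂ e = ≤-trans (≤-reflexive e) (s≤s down)
               , m≤n⇒m≤1+n (≤-trans up (+-monoʳ-≤ k (≤-trans (n≤1+n _) (≤-reflexive (≡-sym e)))))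

  2≤degree-inner : ∀ {u i} → pos u ≡ suc i → suc (pos u) < n → 2 ≤ degree path u
  2≤degree-inner {u} {i} pu 1+u<n = distinctNeighbours⇒2≤degree path {u} {at i<n} {at 1+u<n} apart
    (path⁺ {u} {at i<n} (inj₂ (trans pu (cong suc (≡-sym (pos-at i<n))))))
    (path⁺ {u} {at 1+u<n} (inj₁ (pos-at 1+u<n)))
    where
    i<n : i < n
    i<n = <-trans (≤-reflexive (≡-sym pu)) (pos<n u)
    apart : at i<n ≢ at 1+u<n
    apart e = m≢1+n+m i {1} (trans (≡-sym (pos-at i<n)) (trans (cong pos e) (trans (pos-at 1+u<n) (cong suc pu))))

  leaf-position : ∀ {u} → IsLeaf path u → pos u ≡ 0 ⊎ suc (pos u) ≡ n
  leaf-position {u} leaf = byPosition (pos u) refl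
    where
    byPosition : ∀ k → pos u ≡ k → pos u ≡ 0 ⊎ suc (pos u) ≡ n
    byPosition zero    pu = inj₁ pu
    byPosition (suc i) pu with m≤n⇒m<n∨m≡n (pos<n u)
    ... | inj₁ 1+u<n = contradiction (≡-sym leaf) (<⇒≢ (2≤degree-inner pu 1+u<n))
    ... | inj₂ 1+u≡n = inj₂ 1+u≡n

  private
    spans : ∀ {a b d k} → d < n → suc a ≡ n → b ≡ 0 → a ≤ k + b → d ≤ k
    spans {k = k} d<n refl refl a≤ = ≤-trans (s≤s⁻¹ d<n) (≤-trans a≤ (≤-reflexive (+-identityʳ k)))

  -- Inner positions have two neighbours, so distinct leaves sit at positions 0 and n - 1, and a
  -- walk between them has at least n - 1 steps.
  path-leafDistance : ∀ {d} → d < n → LeafDistance≥ path d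
  path-leafDistance {d} d<n u v leafᵤ leafᵥ u≢v k walk
    with leaf-position {u} leafᵤ | leaf-position {v} leafᵥ | walk-length walk
  ... | inj₁ u≡0 | inj₁ v≡0 | _ = contradiction (pos-injective (trans u≡0 (≡-sym v≡0))) u≢v
  ... | inj₂ u≡n | inj₂ v≡n | _ = contradiction (pos-injective (suc-injective (trans u≡n (≡-sym v≡n)))) u≢v
  ... | inj₁ u≡0 | inj₂ v≡n | _ , v≤ = spans d<n v≡n u≡0 v≤
  ... | inj₂ u≡n | inj₁ v≡0 | u≤ , _ = spans d<n u≡n v≡0 u≤

-- From a Hamiltonian cycle to a spanning path.

lookup-linked : ∀ {A : Set} {R : A → A → Set} {xs} → Linked R xs →
  ∀ i j → toℕ j ≡ suc (toℕ i) → R (lookup xs i) (lookup xs j)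
lookup-linked (r ∷ _)  zero    (suc zero) _ = r
lookup-linked (_ ∷ rs) (suc i) (suc j)    e = lookup-linked rs i j (suc-injective e)

unique-lookup-injective : ∀ {A : Set} {xs : List A} → Unique xs → ∀ i j → lookup xs i ≡ lookup xs j → i ≡ j
unique-lookup-injective (_ ∷ _)  zero    zero    _ = refl
unique-lookup-injective (x∉ ∷ _) zero    (suc j) e = contradiction e (All.lookup x∉ (∈-lookup j))
unique-lookup-injective (x∉ ∷ _) (suc i) zero    e = contradiction (≡-sym e) (All.lookup x∉ (∈-lookup i))
unique-lookup-injective (_ ∷ u)  (suc i) (suc j) e = cong suc (unique-lookup-injective u i j e)

-- The list omits the end of the trail, so the last edge drops out: a Hamiltonian cycle turns into a
-- Hamiltonian path.
trail-linked : ∀ {G : Graph n} {a b k vs} → k ≡ 0 → Trail G a b k vs → Linked (Adj G) vs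
trail-linked _  []                     = []
trail-linked _  (edge _ [])            = [-]
trail-linked k0 (edge e p@(edge _ _))  = e ∷ trail-linked k0 p
trail-linked () (edge _ (jump _ _ _))
trail-linked () (jump _ _ _)

hamiltonian-pathTree : ∀ {n} {G : Graph n} → Hamiltonian G → ∀ {d} → d < n →
  ∃[ T ] (IsSpanningTree G T × LeafDistance≥ T d)
hamiltonian-pathTree {n} {G} (a , vs , p , vs↭) d<n = path , (spanning , path-isTree) , path-leafDistance d<n
  where
  linked : Linked (Adj G) vs
  linked = trail-linked refl p

  unique : Unique vs
  unique = ↭ₛ.Unique-resp-↭ (setoid (Fin n)) (↭⇒↭ₛ (↭-sym vs↭)) (allFin⁺ n)

  length≡n : length vs ≡ n
  length≡n = trans (↭-length vs↭) (length-tabulate {n = n} id)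

  v∈vs : ∀ v → v ∈ vs
  v∈vs v = ∈-resp-↭ (↭-sym vs↭) (∈-allFin v)

  idx : Fin n → Fin (length vs)
  idx v = index (v∈vs v)

  lookup-idx : ∀ v → v ≡ lookup vs (idx v)
  lookup-idx v = lookup-index (v∈vs v)

  i<length : ∀ {i} → i < n → i < length vs
  i<length = subst (_ <_) (≡-sym length≡n)

  open Path (toℕ ∘ idx)
    (λ {u} {v} e → trans (lookup-idx u) (trans (cong (lookup vs) (Fin.toℕ-injective e)) (≡-sym (lookup-idx v))))
    (λ u → subst (toℕ (idx u) <_) length≡n (Fin.toℕ<n (idx u)))
    (λ i<n → lookup vs (fromℕ< (i<length i<n)))
    -- As the list has no repetitions, the index found for its i-th entry is i itself.
    (λ i<n → trans (cong toℕ (unique-lookup-injective unique _ _ (≡-sym (lookup-idx _)))) (Fin.toℕ-fromℕ< (i<length i<n)))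

  consecutive : ∀ {u v} → toℕ (idx v) ≡ suc (toℕ (idx u)) → Adj G u v
  consecutive {u} {v} e = subst₂ (Adj G) (≡-sym (lookup-idx u)) (≡-sym (lookup-idx v)) (lookup-linked linked (idx u) (idx v) e)

  spanning : ∀ u v → Adj path u v → Adj G u v
  spanning u v uv with path⁻ {u} {v} uv
  ... | inj₁ e = consecutive e
  ... | inj₂ e = Adj-sym G (consecutive e)

-- Both edge bounds are doubled to clear the halves, and the negative term of the first is moved
-- across as 2t.
theorem1p3 : (t n : ℕ) → 1 ≤ t → 5 ≤ n → (G : Graph n) → Connected G → minDegree≥ G t →
    ((n ≡ 5 ⊎ 6 * t + 1 ≤ n) →
    2 * ((n ∸ t) C 2) + 3 * t * t + 1 < 2 * edgeCount G + 2 * t) →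
    ((6 ≤ n × n ≤ 6 * t) →
    2 * ((n ∸ t) C 2) + 3 * t * t + t < 2 * edgeCount G) →
    ∃[ T ] (IsSpanningTree G T × LeafDistance≥ T 4)
theorem1p3 t n 1≤t 5≤n G _ minDeg outer middle = hamiltonian-pathTree
  (erdős (≤-trans (s≤s (s≤s z≤n)) 5≤n) G t minDeg λ h m t≤h n≡ →
    <-≤-trans (edgeBound⇒erdősBound t n (edgeCount G) 1≤t 5≤n outer middle h m t≤h n≡) (2*edgeCount≤degreeSum G))
  -- Read as 4 < n: the ends of the path are at distance n - 1 ≥ 4.
  5≤n
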